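{- Let $\ell \geq 2$ be an integer, and let $\varepsilon_0 \in (0,\frac{1}{2\ell})$ and $d_0 \ge 1/\varepsilon_0$ be real. Let $G=(A,B)$ be a bipartite graph such that $|A| > \ell |B|$ and every vertex in $A$ has at least $d_0$ neighbors in $B$. Then $G$ contains at least one of the following: (i) a subgraph $H$ with $|V(H)| \le 3d_0$ and $|E(H)|\ge \varepsilon_0^2 d_0^2/2$, or (ii) an $(\ell+1)$-bounded minor $G'$ with $\mathrm{d}(G') \ge \frac{\ell}{2}(1- 2 \ell \varepsilon_0)d_0$.
   Context: All graphs are finite and simple. $\mathrm{d}(G)=|E(G)|/|V(G)|$ denotes density. An $m$-bounded minor of $G$ is a minor having a model in $G$ in which every branch set has at most $m$ vertices (i.e. obtained from a subgraph by contracting connected subgraphs on at most $m$ vertices).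
   Formalization: The parameters ε₀ and d₀, which the statement takes to be real, are restricted to rational numbers. -}

module Defs where

open import Data.Nat using (ℕ; zero; suc; _≤_; _<ᵇ_)
open import Data.Fin using (Fin; toℕ)
open import Data.Bool using (Bool; true; false; if_then_else_; _∧_; not; _xor_)
open import Data.List using (List; map; allFin)
open import Data.Nat.ListAction using (sum)
open import Data.Integer using (+_)
open import Data.Rational using (ℚ; _/_; 0ℚ)
open import Data.Product using (Σ; _×_; _,_)
open import Relation.Binary.PropositionalEquality using (_≡_; _≢_)
open import Function.Definitions using (Injective)

record Graph : Set where
  field
    n     : ℕ
    adj   : Fin n → Fin n → Bool
    sym   : ∀ u v → adj u v ≡ adj v u
    irrefl : ∀ u → adj u u ≡ false
open Graph public

count : {k : ℕ} → (Fin k → Bool) → ℕ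
count {k} p = sum (map (λ i → if p i then 1 else 0) (allFin k))

edges : Graph → ℕ
edges G = sum (map (λ u → count (λ v → (toℕ u <ᵇ toℕ v) ∧ adj G u v)) (allFin (n G)))

ℕ→ℚ : ℕ → ℚ
ℕ→ℚ k = + k / 1

-- density d(G) = |E(G)| / |V(G)|  (the empty graph, where it is undefined, gets 0)
density : Graph → ℚ
density G with n G
... | zero  = 0ℚ
... | suc m = + edges G / suc m

IsSubgraphOf : Graph → Graph → Set
IsSubgraphOf H G = Σ (Fin (n H) → Fin (n G)) λ f →
  Injective _≡_ _≡_ f × (∀ u v → adj H u v ≡ true → adj G (f u) (f v) ≡ true)

data WalkIn (G : Graph) (S : Fin (n G) → Bool) : Fin (n G) → Fin (n G) → Set where
  stay : ∀ u → S u ≡ true → WalkIn G S u u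
  step : ∀ u v w → S u ≡ true → adj G u v ≡ true → WalkIn G S v w → WalkIn G S u w

-- G[S] is connected (S nonempty is required separately)
ConnectedIn : (G : Graph) → (Fin (n G) → Bool) → Set
ConnectedIn G S = ∀ u v → S u ≡ true → S v ≡ true → WalkIn G S u v

IsBoundedMinorOf : ℕ → Graph → Graph → Set
IsBoundedMinorOf m M G = Σ (Fin (n M) → Fin (n G) → Bool) λ V →
    (∀ x → Σ (Fin (n G)) λ u → V x u ≡ true)
  × (∀ x → count (V x) ≤ m)
  × (∀ x → ConnectedIn G (V x))
  × (∀ x y → x ≢ y → ∀ u → V x u ≡ true → V y u ≡ false)
  × (∀ x y → adj M x y ≡ true →
       Σ (Fin (n G)) λ u → Σ (Fin (n G)) λ v →
         V x u ≡ true × V y v ≡ true × adj G u v ≡ true)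

-- (A,B) bipartition of G given by side: A = side⁻¹(true), B = side⁻¹(false);
-- every edge goes between A and B
IsBipartition : (G : Graph) → (Fin (n G) → Bool) → Set
IsBipartition G side = ∀ u v → adj G u v ≡ true → side u ≢ side v

degInB : (G : Graph) → (Fin (n G) → Bool) → Fin (n G) → ℕ
degInB G side u = count (λ v → not (side v) ∧ adj G u v)

{-# OPTIONS --safe #-}
-- Put s + 1 = ⌈ε₀ d₀⌉ and D = ⌈d₀⌉, keep exactly D neighbours in B of every vertex of A, and call two
-- vertices of A mates if they have more than s common neighbours.  If some a has more than s mates, then
-- N(a) together with s + 1 of them spans at least (s + 1)² / 2 edges.  Otherwise take a largest partial
-- assignment f of vertices of A to neighbours in B whose fibres are pairwise unmated and of size at most ℓ.
-- As |A| > ℓ |B|, some a₀ is unassigned.  Alternating paths from a₀ reach a set R of vertices of B with full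
-- fibres, and a neighbour in B ∖ R of a reached vertex a has a mate of a in its fibre, so every reached vertex
-- has at least D − s neighbours in R.  Contracting the stars of R gives a minor on R in which
-- each vertex has degree at least ℓ (D − s) − ℓ² s − 1.
module Submission where

open import Defs
open import Data.Nat using (ℕ; _≤_; _<_; _*_; _+_)
open import Data.Fin using (Fin)
open import Data.Bool using (Bool; true; not)
open import Data.Sum using (_⊎_)
open import Data.Product using (Σ; _×_)
open import Relation.Binary.PropositionalEquality using (_≡_)
open import Data.Rational using (ℚ; 0ℚ; 1ℚ; ½) renaming (_≤_ to _≤ℚ_; _<_ to _<ℚ_; _*_ to _*ℚ_; _-_ to _-ℚ_)
open import Data.Bool using (false; if_then_else_; _∧_; _∨_)
open import Data.Bool.Properties using (¬-not; not-involutive; ∧-comm; ∨-comm; ∧-conicalˡ; ∧-conicalʳ; ∨-conicalʳ; T-≡) renaming (_≟_ to _≟ᵇ_)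
open import Data.Fin using (zero; suc; toℕ)
open import Data.Fin.Properties using (_≟_; any?; all?; suc-injective; toℕ-injective)
import Data.Integer as ℤ
import Data.Integer.Properties as ℤ
open import Data.List using (map; allFin; tabulate)
open import Data.List.Properties using (map-tabulate)
open import Data.Maybe using (Maybe; just; nothing; is-just)
open import Data.Nat using (zero; suc; z≤n; s≤s; _<?_; _<ᵇ_)
open import Data.Nat.ListAction using () renaming (sum to sumᴸ)
import Data.Nat.Properties as ℕ
open import Data.Nat.Properties using (+-*-semiring; ≤-refl; ≤-reflexive; ≤-trans; +-mono-≤; +-monoˡ-≤; +-monoʳ-≤; m≤m+n; m≤n+m; +-suc; +-comm; +-assoc; *-identityˡ; *-identityʳ; +-identityʳ; <-irrefl; ≤-<-trans; <-≤-trans; ≮⇒≥; ≤-antisym; <⇒<ᵇ; <-cmp; +-cancelʳ-<; module ≤-Reasoning)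
open import Data.Nat.Solver using () renaming (module +-*-Solver to ℕ-Solver)
open import Algebra.Properties.Semiring.Sum +-*-semiring using (sum; sum-cong-≗; sum-replicate-zero; ∑-distrib-+; ∑-comm; *-distribˡ-sum; *-distribʳ-sum)
open import Data.Product using (∃; _,_; proj₁; proj₂)
open import Data.Rational using (toℚᵘ; nonNegative; positive) renaming (_+_ to _+ℚ_; _/_ to _/ℚ_)
import Data.Rational.Properties as ℚ
open import Data.Rational.Solver using () renaming (module +-*-Solver to ℚ-Solver)
open import Data.Rational.Unnormalised using (mkℚᵘ; *≡*; *≤*) renaming (_≃_ to _≃ᵘ_; _+_ to _+ᵘ_; _*_ to _*ᵘ_)
import Data.Rational.Unnormalised.Properties as ℚᵘ
open import Data.Sum using (inj₁; inj₂) renaming (map to map-⊎)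
open import Data.Vec.Functional using (updateAt)
open import Data.Vec.Functional.Properties using (updateAt-updates; updateAt-minimal)
open import Function using (_∘_; id; const; Equivalence)
open import Function.Definitions using (Injective)
open import Relation.Binary using (tri<; tri≈; tri>)
open import Relation.Binary.PropositionalEquality using (_≢_; refl; trans; cong; cong₂; subst; subst₂) renaming (sym to ≡-sym)
open import Relation.Nullary using (Dec; yes; no; does; contradiction)
open import Relation.Nullary.Decidable using (dec-true; dec-false; _×-dec_; _⊎-dec_; _→-dec_)

-- Counting and enumerating finite sets given by Boolean predicates.

private variable
  k m : ℕ

ι : Bool → ℕ
ι b = if b then 1 else 0

# : (Fin k → Bool) → ℕ
# p = sum (λ i → ι (p i))

∧-intro : ∀ {x y} → x ≡ true → y ≡ true → x ∧ y ≡ true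
∧-intro refl refl = refl

∧-elimˡ : ∀ {x y} → x ∧ y ≡ true → x ≡ true
∧-elimˡ {x} {y} = ∧-conicalˡ x y

∧-elimʳ : ∀ {x y} → x ∧ y ≡ true → y ≡ true
∧-elimʳ {x} {y} = ∧-conicalʳ x y

∨-introˡ : ∀ {x y} → x ≡ true → x ∨ y ≡ true
∨-introˡ refl = refl

∨-introʳ : ∀ {x y} → y ≡ true → x ∨ y ≡ true
∨-introʳ {true}  _  = refl
∨-introʳ {false} eq = eq

∨-elim : ∀ {x y} → x ∨ y ≡ true → x ≡ true ⊎ y ≡ true
∨-elim {true}  _  = inj₁ refl
∨-elim {false} eq = inj₂ eq

does-true : ∀ {a} {P : Set a} (P? : Dec P) → does P? ≡ true → P
does-true (yes p) _ = p

anyᵇ : (Fin k → Bool) → Bool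
anyᵇ p = does (any? (λ i → p i ≟ᵇ true))

anyᵇ-intro : (p : Fin k → Bool) (i : Fin k) → p i ≡ true → anyᵇ p ≡ true
anyᵇ-intro p i pi = dec-true (any? (λ i → p i ≟ᵇ true)) (i , pi)

anyᵇ-elim : (p : Fin k → Bool) → anyᵇ p ≡ true → ∃ λ i → p i ≡ true
anyᵇ-elim p = does-true (any? (λ i → p i ≟ᵇ true))

sumᴸ≡sum : (f : Fin k → ℕ) → sumᴸ (map f (allFin k)) ≡ sum f
sumᴸ≡sum f = trans (cong sumᴸ (map-tabulate id f)) (go f)
  where
  go : ∀ {k} (f : Fin k → ℕ) → sumᴸ (tabulate f) ≡ sum f
  go {zero}  f = refl
  go {suc k} f = cong (f zero +_) (go (f ∘ suc))

count≡# : (p : Fin k → Bool) → count p ≡ # p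
count≡# p = sumᴸ≡sum (λ i → ι (p i))

sum-mono : {f g : Fin k → ℕ} → (∀ i → f i ≤ g i) → sum f ≤ sum g
sum-mono {zero}  f≤g = z≤n
sum-mono {suc k} f≤g = +-mono-≤ (f≤g zero) (sum-mono (f≤g ∘ suc))

term≤sum : (f : Fin k → ℕ) (i : Fin k) → f i ≤ sum f
term≤sum f zero    = m≤m+n (f zero) _
term≤sum f (suc i) = ≤-trans (term≤sum (f ∘ suc) i) (m≤n+m _ (f zero))

sum-const : (c : ℕ) → sum {k} (const c) ≡ k * c
sum-const {zero}  c = refl
sum-const {suc k} c = cong (c +_) (sum-const {k} c)

ι-mono : ∀ {x y} → (x ≡ true → y ≡ true) → ι x ≤ ι y
ι-mono {false} _ = z≤n
ι-mono {true}  h rewrite h refl = ≤-refl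

ι-≥1 : ∀ {x c} → (x ≡ true → 1 ≤ c) → ι x ≤ c
ι-≥1 {false} _ = z≤n
ι-≥1 {true}  h = h refl

ι-∧ : ∀ x y → ι (x ∧ y) ≡ ι x * ι y
ι-∧ false y = refl
ι-∧ true  y = ≡-sym (+-identityʳ (ι y))

#-mono : {p q : Fin k → Bool} → (∀ i → p i ≡ true → q i ≡ true) → # p ≤ # q
#-mono p⊆q = sum-mono (λ i → ι-mono (p⊆q i))

#-cong : {p q : Fin k → Bool} → (∀ i → p i ≡ q i) → # p ≡ # q
#-cong p≗q = sum-cong-≗ (λ i → cong ι (p≗q i))

#-none : {p : Fin k → Bool} → (∀ i → p i ≡ false) → # p ≡ 0
#-none {k} h = trans (#-cong h) (sum-replicate-zero k)

#≤k : (p : Fin k → Bool) → # p ≤ k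
#≤k {k} p = ≤-trans (sum-mono {g = const 1} (λ i → ι-≥1 {p i} (λ _ → ≤-refl)))
                (≤-reflexive (trans (sum-const {k} 1) (*-identityʳ k)))

#-≟ : (c : Fin k) → # (λ i → does (c ≟ i)) ≡ 1
#-≟ {suc k} zero    = cong suc (#-none {k} (λ _ → refl))
#-≟ {suc k} (suc c) = #-≟ c

#-∨-∧ : (p q : Fin k → Bool) → # (λ i → p i ∨ q i) + # (λ i → p i ∧ q i) ≡ # p + # q
#-∨-∧ p q = trans (≡-sym (∑-distrib-+ (λ i → ι (p i ∨ q i)) (λ i → ι (p i ∧ q i))))
  (trans (sum-cong-≗ (λ i → pt (p i) (q i))) (∑-distrib-+ (λ i → ι (p i)) (λ i → ι (q i))))
  where
  pt : ∀ x y → ι (x ∨ y) + ι (x ∧ y) ≡ ι x + ι y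
  pt false y = +-identityʳ _
  pt true false = refl
  pt true true = refl

#-∨≤ : (p q : Fin k → Bool) → # (λ i → p i ∨ q i) ≤ # p + # q
#-∨≤ p q = ≤-trans (m≤m+n _ _) (≤-reflexive (#-∨-∧ p q))

#-insert : {p q : Fin k → Bool} (a : Fin k) → p a ≡ false → q a ≡ true → (∀ x → x ≢ a → q x ≡ p x) → # q ≡ suc (# p)
#-insert {p = p} {q} zero pa qa same rewrite pa | qa = cong suc (#-cong (λ i → same (suc i) λ ()))
#-insert {p = p} {q} (suc a) pa qa same =
  trans (cong₂ _+_ (cong ι (same zero λ ())) (#-insert a pa qa (λ x x≢a → same (suc x) (x≢a ∘ suc-injective)))) (+-suc _ _)

#<⇒∃ : {p q : Fin k → Bool} → # p < # q → ∃ λ i → q i ≡ true × p i ≡ false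
#<⇒∃ {p = p} {q} lt with any? (λ i → (q i ∧ not (p i)) ≟ᵇ true)
... | yes (i , e) = i , ∧-elimˡ e , not-true (p i) (∧-elimʳ {q i} e)
  where
  not-true : ∀ x → not x ≡ true → x ≡ false
  not-true false _ = refl
... | no none = contradiction (≤-<-trans (#-mono q⊆p) lt) (<-irrefl refl)
  where
  q⊆p : ∀ i → q i ≡ true → p i ≡ true
  q⊆p i qi with p i in eq
  ... | true  = refl
  ... | false = contradiction (i , ∧-intro qi (cong not eq)) none

#>0⇒∃ : {p : Fin k → Bool} → 0 < # p → ∃ λ i → p i ≡ true
#>0⇒∃ {k} {p} pos with #<⇒∃ {p = λ (_ : Fin k) → false} {p} (≤-<-trans (≤-reflexive (sum-replicate-zero k)) pos)
... | i , pi , _ = i , pi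

#-subset : (p : Fin k → Bool) (c : ℕ) → c ≤ # p → Σ (Fin k → Bool) λ q → (∀ i → q i ≡ true → p i ≡ true) × # q ≡ c
#-subset {k} p zero _ = const false , (λ _ ()) , sum-replicate-zero k
#-subset {zero}  p (suc c) ()
#-subset {suc k} p (suc c) le with p zero in eq
... | true  with le
...   | s≤s le' with #-subset (p ∘ suc) c le'
...     | q , q⊆p , #q = (λ { zero → true ; (suc i) → q i })
                       , (λ { zero _ → eq ; (suc i) → q⊆p i })
                       , cong suc #q
#-subset {suc k} p (suc c) le | false with #-subset (p ∘ suc) (suc c) le
... | q , q⊆p , #q = (λ { zero → false ; (suc i) → q i })
                       , (λ { zero () ; (suc i) → q⊆p i })
                       , #q

hits : Maybe (Fin k) → Fin k → Bool
hits nothing  _ = false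
hits (just c) b = does (c ≟ b)

hits-just : (b : Fin k) → hits (just b) b ≡ true
hits-just b = dec-true (b ≟ b) refl

hits⇒≡ : {x : Maybe (Fin k)} {b : Fin k} → hits x b ≡ true → x ≡ just b
hits⇒≡ {x = just c} {b} h = cong just (does-true (c ≟ b) h)

#-hits≤1 : (x : Maybe (Fin k)) → # (hits x) ≤ 1
#-hits≤1 {k} nothing  = ≤-trans (≤-reflexive (sum-replicate-zero k)) z≤n
#-hits≤1     (just c) = ≤-reflexive (#-≟ c)

-- Double counting of the pairs `(a , b)` with `q a` true and `g a ≡ just b`: each `b` in `p` occurs
-- in at least one pair, and each `a` in at most one because `g` is single-valued.
#-image : (g : Fin m → Maybe (Fin k)) {q : Fin m → Bool} {p : Fin k → Bool}
  → (∀ b → p b ≡ true → ∃ λ a → q a ≡ true × hits (g a) b ≡ true) → # p ≤ # q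
#-image g {q} {p} cover = begin
  # p                                                ≤⟨ sum-mono (λ b → ι-≥1 (λ pb → hit b (cover b pb))) ⟩
  sum (λ b → sum (λ a → ι (q a ∧ hits (g a) b)))     ≡⟨ ∑-comm (λ b a → ι (q a ∧ hits (g a) b)) ⟩
  sum (λ a → sum (λ b → ι (q a ∧ hits (g a) b)))     ≤⟨ sum-mono (λ a → row (q a) (g a)) ⟩
  # q                                                ∎
  where
  open ≤-Reasoning
  hit : ∀ b → (∃ λ a → q a ≡ true × hits (g a) b ≡ true) → 1 ≤ sum (λ a → ι (q a ∧ hits (g a) b))
  hit b (a , qa , ga) = ≤-trans (≤-reflexive (≡-sym (cong ι (∧-intro qa ga)))) (term≤sum (λ a → ι (q a ∧ hits (g a) b)) a)
  row : ∀ x y → # (λ b → x ∧ hits y b) ≤ ι x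
  row false y = ≤-reflexive (#-none {p = λ b → false ∧ hits y b} (λ _ → refl))
  row true  y = #-hits≤1 y

#-∧-anyᵇ : (p : Fin k → Bool) (g : Fin m → Fin k → Bool)
  → # (λ x → p x ∧ anyᵇ (λ i → g i x)) ≤ sum (λ i → # (λ x → p x ∧ g i x))
#-∧-anyᵇ p g = ≤-trans (sum-mono (λ x → ι-≥1 (λ e → hit x (∧-elimˡ e) (anyᵇ-elim _ (∧-elimʳ {p x} e)))))
                       (≤-reflexive (∑-comm (λ x i → ι (p x ∧ g i x))))
  where
  hit : ∀ x → p x ≡ true → (∃ λ i → g i x ≡ true) → 1 ≤ sum (λ i → ι (p x ∧ g i x))
  hit x px (i , gix) = ≤-trans (≤-reflexive (≡-sym (cong ι (∧-intro px gix)))) (term≤sum (λ i → ι (p x ∧ g i x)) i)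

-- A Bonferroni inequality, by induction on the number of sets: adding one set to the union of `m`
-- others loses at most `m * s`, the total of its pairwise overlaps.
sum-#≤#-anyᵇ : (s : ℕ) (g : Fin m → Fin k → Bool) → (∀ i j → i ≢ j → # (λ x → g i x ∧ g j x) ≤ s)
  → sum (λ i → # (g i)) ≤ # (λ x → anyᵇ (λ i → g i x)) + m * m * s
sum-#≤#-anyᵇ {zero}  s g small = z≤n
sum-#≤#-anyᵇ {suc m} s g small = begin
  # (g zero) + sum (λ i → # (g (suc i)))           ≤⟨ +-monoʳ-≤ (# (g zero)) (sum-#≤#-anyᵇ s (g ∘ suc) (λ i j i≢j → small (suc i) (suc j) (i≢j ∘ suc-injective))) ⟩
  # (g zero) + (# rest + m * m * s)                 ≡⟨ +-assoc (# (g zero)) (# rest) _ ⟨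
  # (g zero) + # rest + m * m * s                   ≡⟨ cong (_+ m * m * s) (#-∨-∧ (g zero) rest) ⟨
  # (λ x → g zero x ∨ rest x) + # (λ x → g zero x ∧ rest x) + m * m * s
    ≤⟨ +-monoˡ-≤ (m * m * s) (+-mono-≤ (#-mono union) common≤) ⟩
  -- The slack `suc m * s` completes `m * m * s + m * s` to `suc m * suc m * s`.
  # all + m * s + m * m * s                         ≤⟨ m≤m+n _ (suc m * s) ⟩
  # all + m * s + m * m * s + suc m * s             ≡⟨ solve 3 (λ u m s → u :+ m :* s :+ m :* m :* s :+ (con 1 :+ m) :* s := u :+ (con 1 :+ m) :* (con 1 :+ m) :* s) refl (# all) m s ⟩
  # all + suc m * suc m * s                         ∎
  where
  open ≤-Reasoning
  open ℕ-Solver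
  rest = λ x → anyᵇ (λ i → g (suc i) x)
  all  = λ x → anyᵇ (λ i → g i x)
  union : ∀ x → g zero x ∨ rest x ≡ true → all x ≡ true
  union x e with ∨-elim {g zero x} e
  ... | inj₁ e₀ = anyᵇ-intro (λ i → g i x) zero e₀
  ... | inj₂ e₁ with anyᵇ-elim (λ i → g (suc i) x) e₁
  ...   | i , ei = anyᵇ-intro (λ i → g i x) (suc i) ei
  common≤ : # (λ x → g zero x ∧ rest x) ≤ m * s
  common≤ = ≤-trans (#-∧-anyᵇ (g zero) (g ∘ suc))
            (≤-trans (sum-mono (λ i → small zero (suc i) λ ())) (≤-reflexive (sum-const {m} s)))

-- `sum-elem` expresses completeness as a change of summation index, so that vertex sums in a graph
-- on the indices `Fin size` become weighted sums over the ambient vertices.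
record Enumeration {k} (p : Fin k → Bool) : Set where
  field
    size      : ℕ
    elem      : Fin size → Fin k
    injective : Injective _≡_ _≡_ elem
    sound     : ∀ i → p (elem i) ≡ true
    sum-elem  : ∀ h → sum (h ∘ elem) ≡ sum (λ b → ι (p b) * h b)

  size≡# : size ≡ # p
  size≡# = trans (≡-sym (trans (sum-const {size} 1) (*-identityʳ size)))
             (trans (sum-elem (const 1)) (sum-cong-≗ (λ b → *-identityʳ (ι (p b)))))

enumerate : (p : Fin k → Bool) → Enumeration p
enumerate {zero} p = record { size = 0 ; elem = λ () ; injective = λ { {()} } ; sound = λ () ; sum-elem = λ _ → refl }
enumerate {suc k} p with p zero in eq | enumerate (p ∘ suc)
... | false | E = record
  { size = size
  ; elem = suc ∘ elem
  ; injective = injective ∘ suc-injective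
  ; sound = sound
  ; sum-elem = λ h → trans (sum-elem (h ∘ suc)) (cong (λ c → ι c * h zero + sum (λ b → ι (p (suc b)) * h (suc b))) (≡-sym eq))
  } where open Enumeration E
... | true | E = record
  { size = suc size
  ; elem = λ { zero → zero ; (suc i) → suc (elem i) }
  ; injective = λ { {zero} {zero} _ → refl ; {suc i} {suc j} e → cong suc (injective (suc-injective e)) }
  ; sound = λ { zero → eq ; (suc i) → sound i }
  ; sum-elem = λ h → trans (cong₂ _+_ (≡-sym (*-identityˡ (h zero))) (sum-elem (h ∘ suc))) (cong (λ c → ι c * h zero + sum (λ b → ι (p (suc b)) * h (suc b))) (≡-sym eq))
  } where open Enumeration E

-- Partial assignments with unmated fibres, and alternating paths.

module Assignments {N : ℕ} (T : Fin N → Fin N → Bool) (ℓ s : ℕ) where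

  common : Fin N → Fin N → ℕ
  common a a' = # (λ b → T a b ∧ T a' b)

  -- The case `a ≡ a'` is included: a vertex whose row in `T` has more than `s` entries is its own
  -- mate, and it is counted as such wherever mates are counted.
  mate : Fin N → Fin N → Bool
  mate a a' = does (s <? common a a')

  mate-sym : ∀ a a' → mate a a' ≡ mate a' a
  mate-sym a a' = cong (λ c → does (s <? c)) (#-cong (λ b → ∧-comm (T a b) (T a' b)))

  unmated⇒common≤ : ∀ a a' → mate a a' ≡ false → common a a' ≤ s
  unmated⇒common≤ a a' e = ≮⇒≥ λ lt → contradiction (trans (≡-sym (dec-true (s <? common a a') lt)) e) λ ()

  Assignment : Set
  Assignment = Fin N → Maybe (Fin N)

  fibre : Assignment → Fin N → Fin N → Bool
  fibre f b a = hits (f a) b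

  assigned : Assignment → ℕ
  assigned f = # (is-just ∘ f)

  record Valid (f : Assignment) : Set where
    field
      along   : ∀ {a b} → fibre f b a ≡ true → T a b ≡ true
      small   : ∀ b → # (fibre f b) ≤ ℓ
      unmated : ∀ {a a' b} → a ≢ a' → fibre f b a ≡ true → fibre f b a' ≡ true → mate a a' ≡ false

  -- The size of the fibre is left out on purpose: a compatible `b` with room ends an alternating
  -- path, and one with a full fibre prolongs it.
  Compatible : Assignment → Fin N → Fin N → Set
  Compatible f a b = T a b ≡ true × (∀ a' → fibre f b a' ≡ true → mate a a' ≡ false)

  remove : Assignment → Fin N → Assignment
  remove f a = updateAt f a (const nothing)

  assign : Assignment → Fin N → Fin N → Assignment
  assign f a b = updateAt f a (const (just b))

  module Remove (f : Assignment) (a b : Fin N) (fa : fibre f b a ≡ true) where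

    at : remove f a a ≡ nothing
    at = updateAt-updates a f

    off : ∀ x → x ≢ a → remove f a x ≡ f x
    off x x≢a = updateAt-minimal x a f x≢a

    ⊆ : ∀ {x y} → fibre (remove f a) y x ≡ true → x ≢ a × fibre f y x ≡ true
    ⊆ {x} {y} e with x ≟ a
    ... | yes refl = contradiction (trans (≡-sym e) (cong (λ z → hits z y) at)) λ ()
    ... | no x≢a   = x≢a , trans (cong (λ z → hits z y) (≡-sym (off x x≢a))) e

    valid : Valid f → Valid (remove f a)
    valid v = record
      { along   = λ e → along (proj₂ (⊆ e))
      ; small   = λ y → ≤-trans (#-mono (λ x e → proj₂ (⊆ {x} {y} e))) (small y)
      ; unmated = λ x≢y e e' → unmated x≢y (proj₂ (⊆ e)) (proj₂ (⊆ e'))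
      } where open Valid v

    #-fibre : # (fibre f b) ≡ suc (# (fibre (remove f a) b))
    #-fibre = #-insert a (cong (λ z → hits z b) at) fa (λ x x≢a → cong (λ z → hits z b) (≡-sym (off x x≢a)))

    #-assigned : assigned f ≡ suc (assigned (remove f a))
    #-assigned = #-insert a (cong is-just at) (cong is-just (hits⇒≡ {x = f a} fa)) (λ x x≢a → cong is-just (≡-sym (off x x≢a)))

    other : ∀ y → y ≢ b → ∀ x → fibre (remove f a) y x ≡ fibre f y x
    other y y≢b x with x ≟ a
    ... | no x≢a = cong (λ z → hits z y) (off x x≢a)
    ... | yes refl rewrite at | hits⇒≡ {x = f a} fa = ≡-sym (dec-false (b ≟ y) (y≢b ∘ ≡-sym))

  module Assign (f : Assignment) (a b : Fin N) (fa : f a ≡ nothing) where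

    at : assign f a b a ≡ just b
    at = updateAt-updates a f

    off : ∀ x → x ≢ a → assign f a b x ≡ f x
    off x x≢a = updateAt-minimal x a f x≢a

    ⊆ : ∀ {x y} → fibre (assign f a b) y x ≡ true → (x ≡ a × y ≡ b) ⊎ (fibre f y x ≡ true)
    ⊆ {x} {y} e with x ≟ a
    ... | yes refl = inj₁ (refl , ≡-sym (does-true (b ≟ y) (trans (cong (λ z → hits z y) (≡-sym at)) e)))
    ... | no x≢a   = inj₂ (trans (cong (λ z → hits z y) (≡-sym (off x x≢a))) e)

    #-fibre : # (fibre (assign f a b) b) ≡ suc (# (fibre f b))
    #-fibre = #-insert a (cong (λ z → hits z b) fa) (trans (cong (λ z → hits z b) at) (hits-just b))
                (λ x x≢a → cong (λ z → hits z b) (off x x≢a))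

    #-assigned : assigned (assign f a b) ≡ suc (assigned f)
    #-assigned = #-insert a (cong is-just fa) (cong is-just at) (λ x x≢a → cong is-just (off x x≢a))

    other : ∀ y → y ≢ b → ∀ x → fibre (assign f a b) y x ≡ fibre f y x
    other y y≢b x with x ≟ a
    ... | no x≢a = cong (λ z → hits z y) (off x x≢a)
    ... | yes refl rewrite at | fa = dec-false (b ≟ y) (y≢b ∘ ≡-sym)

    valid : Valid f → Compatible f a b → # (fibre f b) < ℓ → Valid (assign f a b)
    valid v (Tab , compat) room = record { along = along' ; small = small' ; unmated = unmated' }
      where
      open Valid v
      along' : ∀ {x y} → fibre (assign f a b) y x ≡ true → T x y ≡ true
      along' e with ⊆ e
      ... | inj₁ (refl , refl) = Tab
      ... | inj₂ e' = along e'
      small' : ∀ y → # (fibre (assign f a b) y) ≤ ℓ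
      small' y with y ≟ b
      ... | yes refl = ≤-trans (≤-reflexive #-fibre) room
      ... | no y≢b   = ≤-trans (≤-reflexive (#-cong (other y y≢b))) (small y)
      unmated' : ∀ {x x' y} → x ≢ x' → fibre (assign f a b) y x ≡ true → fibre (assign f a b) y x' ≡ true → mate x x' ≡ false
      unmated' {x} {x'} x≢x' e e' with ⊆ e | ⊆ e'
      ... | inj₁ (refl , refl) | inj₁ (refl , _) = contradiction refl x≢x'
      ... | inj₁ (refl , refl) | inj₂ h'         = compat x' h'
      ... | inj₂ h | inj₁ (refl , refl)          = trans (mate-sym x x') (compat x h)
      ... | inj₂ h | inj₂ h'                     = unmated x≢x' h h'

  module Search (f : Assignment) (f-valid : Valid f) (a₀ : Fin N) (f-a₀ : f a₀ ≡ nothing) where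

    Reached : (Fin N → Bool) → Fin N → Set
    Reached R a = a ≡ a₀ ⊎ (∃ λ b → fibre f b a ≡ true × R b ≡ true)

    -- f can be rearranged inside the stars of R so that a becomes free.
    record Freed (R : Fin N → Bool) (a : Fin N) : Set where
      field
        g       : Assignment
        valid   : Valid g
        free    : g a ≡ nothing
        no-loss : assigned f ≤ assigned g
        outside : ∀ b → R b ≡ false → ∀ x → fibre g b x ≡ fibre f b x

    -- `freed` lets the search go on from any reached vertex; `full` later provides exactly `ℓ`
    -- leaves for each star of `R`.
    record Invariant (R : Fin N → Bool) : Set where
      field
        full  : ∀ b → R b ≡ true → # (fibre f b) ≡ ℓ
        freed : ∀ a → Reached R a → Freed R a

    Closed : (Fin N → Bool) → Set
    Closed R = ∀ a → Reached R a → ∀ b → Compatible f a b → R b ≡ true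

    Improvement : Set
    Improvement = ∃ λ g → Valid g × assigned f < assigned g

    reached? : ∀ R a → Dec (Reached R a)
    reached? R a = (a ≟ a₀) ⊎-dec any? (λ b → (fibre f b a ≟ᵇ true) ×-dec (R b ≟ᵇ true))

    compatible? : ∀ a b → Dec (Compatible f a b)
    compatible? a b = (T a b ≟ᵇ true) ×-dec all? (λ a' → (fibre f b a' ≟ᵇ true) →-dec (mate a a' ≟ᵇ false))

    insert : (Fin N → Bool) → Fin N → Fin N → Bool
    insert R b y = does (b ≟ y) ∨ R y

    -- The rearrangement touches only fibres over `R`, so a `b` outside `R` has the same fibre under
    -- `f` and under the rearranged assignment.
    compatible-freed : ∀ {R a b} (F : Freed R a) → R b ≡ false → Compatible f a b → Compatible (Freed.g F) a b
    compatible-freed F Rb (Tab , c) = Tab , λ a' e → c a' (trans (≡-sym (Freed.outside F _ Rb a')) e)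

    -- The end of an augmenting path: once `a` is freed at no loss, placing it at a `b` with room
    -- gains one assigned vertex.
    augment : ∀ {R a b} → Freed R a → R b ≡ false → Compatible f a b → # (fibre f b) < ℓ → Improvement
    augment {R} {a} {b} F Rb c room = assign g a b
      , A.valid valid (compatible-freed F Rb c) (subst (_< ℓ) (≡-sym (#-cong (outside b Rb))) room)
      , ≤-trans (s≤s no-loss) (≤-reflexive (≡-sym A.#-assigned))
      where
      open Freed F
      module A = Assign g a b free

    -- One alternation: `a'` leaves the fibre of `b` and the freed `a` takes its place. The number
    -- of assigned vertices is unchanged by the swap, and beyond `R` only the fibre of `b` is
    -- affected.
    exchange : ∀ {R a b a'} → Freed R a → R b ≡ false → Compatible f a b → fibre f b a' ≡ true → Freed (insert R b) a'
    exchange {R} {a} {b} {a'} F Rb c fa' = record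
      { g       = assign g₁ a b
      -- There is room for `a` because the fibre of `b` had at most `ℓ` elements before `a'` left
      -- it.
      ; valid   = A.valid (Rm.valid valid) compat (≤-trans (≤-reflexive (≡-sym Rm.#-fibre)) (Valid.small valid b))
      ; free    = trans (A.off a' a'≢a) Rm.at
      ; no-loss = ≤-trans no-loss (≤-reflexive (trans Rm.#-assigned (≡-sym A.#-assigned)))
      ; outside = λ y e x → trans (A.other y (y≢b y e) x) (trans (Rm.other y (y≢b y e) x) (outside y (∨-conicalʳ (does (b ≟ y)) (R y) e) x))
      }
      where
      open Freed F
      ga' : fibre g b a' ≡ true
      ga' = trans (outside b Rb a') fa'
      -- `a` is free under `g`, whereas `a'` still sits in the fibre of `b`.
      a'≢a : a' ≢ a
      a'≢a refl = contradiction (trans (≡-sym ga') (cong (λ z → hits z b) free)) λ ()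
      module Rm = Remove g a' b ga'
      g₁ = remove g a'
      compat : Compatible g₁ a b
      compat with compatible-freed F Rb c
      ... | Tab , c' = Tab , λ x e → c' x (proj₂ (Rm.⊆ {x} {b} e))
      module A = Assign g₁ a b (trans (Rm.off a (a'≢a ∘ ≡-sym)) free)
      y≢b : ∀ y → insert R b y ≡ false → y ≢ b
      y≢b y e refl = contradiction (trans (≡-sym e) (∨-introˡ (dec-true (b ≟ b) refl))) λ ()

    weaken : ∀ {R a b} → Freed R a → Freed (insert R b) a
    weaken {R} {a} {b} F = record
      { g = g ; valid = valid ; free = free ; no-loss = no-loss
      ; outside = λ y e → outside y (∨-conicalʳ (does (b ≟ y)) (R y) e) }
      where
      open Freed F

    invariant-∅ : Invariant (const false)
    invariant-∅ = record
      { full  = λ _ ()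
      ; freed = λ { _ (inj₁ refl) → record { g = f ; valid = f-valid ; free = f-a₀ ; no-loss = ≤-refl ; outside = λ _ _ _ → refl }
                  ; _ (inj₂ (_ , _ , ())) } }

    -- The vertices newly reached are the members of the fibre of `b`; each is freed by exchanging
    -- it with `a`. For the others the rearrangement over `R` still serves over the larger set.
    invariant-insert : ∀ {R a b} → Invariant R → Reached R a → R b ≡ false → Compatible f a b → # (fibre f b) ≡ ℓ → Invariant (insert R b)
    invariant-insert {R} {a} {b} I r Rb c eq = record { full = full' ; freed = freed' }
      where
      open Invariant I
      full' : ∀ y → insert R b y ≡ true → # (fibre f y) ≡ ℓ
      full' y e with ∨-elim {does (b ≟ y)} e
      ... | inj₁ h with does-true (b ≟ y) h
      ...   | refl = eq
      full' y e | inj₂ h = full y h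
      freed' : ∀ x → Reached (insert R b) x → Freed (insert R b) x
      freed' x (inj₁ x≡a₀) = weaken {b = b} (freed x (inj₁ x≡a₀))
      freed' x (inj₂ (y , fx , e)) with ∨-elim {does (b ≟ y)} e
      ... | inj₂ h = weaken {b = b} (freed x (inj₂ (y , fx , h)))
      ... | inj₁ h with does-true (b ≟ y) h
      ...   | refl = exchange (freed a r) Rb c fx

    -- Every round adds a vertex to `R`, so `N` rounds suffice; `enough` records that the fuel
    -- covers the vertices still outside `R`.
    explore : (fuel : ℕ) (R : Fin N → Bool) → N ≤ # R + fuel → Invariant R
      → Improvement ⊎ (∃ λ R → Invariant R × Closed R)
    explore fuel R enough I
      with any? (λ a → any? (λ b → reached? R a ×-dec (compatible? a b ×-dec (R b ≟ᵇ false))))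
    ... | no none = inj₂ (R , I , λ a r b c → ¬-not (λ Rb → none (a , b , r , c , Rb)))
    ... | yes (a , b , r , c , Rb) with # (fibre f b) <? ℓ
    ...   | yes room = inj₁ (augment (Invariant.freed I a r) Rb c room)
    ...   | no  tight = continue fuel enough
      where
      grown : # (insert R b) ≡ suc (# R)
      grown = #-insert b Rb (∨-introˡ (dec-true (b ≟ b) refl)) (λ y y≢b → cong (_∨ R y) (dec-false (b ≟ y) (y≢b ∘ ≡-sym)))
      continue : (fuel : ℕ) → N ≤ # R + fuel → Improvement ⊎ (∃ λ R → Invariant R × Closed R)
      -- Without fuel `R` would already contain all `N` vertices, yet `b` lies outside it.
      continue zero enough = contradiction
        (≤-<-trans (≤-trans enough (≤-reflexive (+-identityʳ (# R)))) (≤-trans (≤-reflexive (≡-sym grown)) (#≤k (insert R b))))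
        (<-irrefl refl)
      continue (suc fuel) enough = explore fuel (insert R b)
        (≤-trans enough (≤-reflexive (trans (+-suc (# R) fuel) (cong (_+ fuel) (≡-sym grown)))))
        (invariant-insert I r Rb c (≤-antisym (Valid.small f-valid b) (≮⇒≥ tight)))

    search : Improvement ⊎ (∃ λ R → Invariant R × Closed R)
    search = explore N (const false) (m≤n+m N _) invariant-∅

  -- The assigned vertices are counted by their targets: fibres over `B` have at most `ℓ` elements
  -- and all others are empty. With `ℓ * # B < # A` this leaves a vertex of `A` unassigned.
  assigned≤ : ∀ {f} (B : Fin N → Bool) → (∀ {a b} → T a b ≡ true → B b ≡ true) → Valid f → assigned f ≤ ℓ * # B
  assigned≤ {f} B T⊆B v = begin
    assigned f                                    ≤⟨ sum-mono (λ a → is-just≤ (f a)) ⟩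
    sum (λ a → sum (λ b → ι (fibre f b a)))       ≡⟨ ∑-comm (λ a b → ι (fibre f b a)) ⟩
    sum (λ b → # (fibre f b))                     ≤⟨ sum-mono bound ⟩
    sum (λ b → ℓ * ι (B b))                       ≡⟨ *-distribˡ-sum ℓ (λ b → ι (B b)) ⟨
    ℓ * # B                                       ∎
    where
    open ≤-Reasoning
    open Valid v
    is-just≤ : (x : Maybe (Fin N)) → ι (is-just x) ≤ # (hits x)
    is-just≤ nothing  = z≤n
    is-just≤ (just c) = ≤-reflexive (≡-sym (#-≟ c))
    bound : ∀ b → # (fibre f b) ≤ ℓ * ι (B b)
    bound b with B b in eq
    ... | true  = ≤-trans (small b) (≤-reflexive (≡-sym (*-identityʳ ℓ)))
    ... | false = ≤-trans (≤-reflexive (#-none {p = fibre f b} (λ a → ¬-not (λ e → contradiction (trans (≡-sym (T⊆B (along e))) eq) λ ())))) z≤n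

  -- `a₀∈A` is recorded because the degree of `a₀` later shows that `R` is nonempty.
  record Saturated (A : Fin N → Bool) : Set where
    field
      f      : Assignment
      valid  : Valid f
      a₀     : Fin N
      a₀∈A   : A a₀ ≡ true
      f-a₀   : f a₀ ≡ nothing
      R      : Fin N → Bool
      full   : ∀ b → R b ≡ true → # (fibre f b) ≡ ℓ
      closed : Search.Closed f valid a₀ f-a₀ R

  -- The assignment is improved until a search fails; a failed search supplies the closed set `R`
  -- that maximality would give. Each improvement raises the number of assigned vertices, which is
  -- at most `N`.
  saturate : (A B : Fin N → Bool) → (∀ {a b} → T a b ≡ true → B b ≡ true) → ℓ * # B < # A → Saturated A
  saturate A B T⊆B large = go N (const nothing) valid-∅ (m≤n+m N _)
    where
    valid-∅ : Valid (const nothing)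
    valid-∅ = record { along = λ () ; small = λ b → ≤-trans (≤-reflexive (#-none {p = fibre (const nothing) b} (λ _ → refl))) z≤n ; unmated = λ _ () }
    is-nothing : (x : Maybe (Fin N)) → is-just x ≡ false → x ≡ nothing
    is-nothing nothing _ = refl
    go : (fuel : ℕ) (f : Assignment) → Valid f → N ≤ assigned f + fuel → Saturated A
    go fuel f v enough with #<⇒∃ {p = is-just ∘ f} {A} (≤-<-trans (assigned≤ B T⊆B v) large)
    ... | a₀ , Aa₀ , e with Search.search f v a₀ (is-nothing (f a₀) e)
    ...   | inj₂ (R , I , closed) = record
      { f = f ; valid = v ; a₀ = a₀ ; a₀∈A = Aa₀ ; f-a₀ = is-nothing (f a₀) e ; R = R
      ; full = Search.Invariant.full I ; closed = closed }
    ...   | inj₁ (g , vg , gain) = continue fuel enough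
      where
      continue : (fuel : ℕ) → N ≤ assigned f + fuel → Saturated A
      continue zero enough = contradiction
        (≤-<-trans (≤-trans enough (≤-reflexive (+-identityʳ _))) (<-≤-trans gain (#≤k (is-just ∘ g))))
        (<-irrefl refl)
      continue (suc fuel) enough = go fuel g vg
        (≤-trans enough (≤-trans (≤-reflexive (+-suc _ fuel)) (+-monoˡ-≤ fuel gain)))

  module _ {A : Fin N → Bool} (S : Saturated A) where
    open Saturated S

    -- A neighbour outside R contains in its star a mate of a, and different stars give different mates.
    neighbours-in-R : ∀ a → Search.Reached f valid a₀ f-a₀ R a → # (mate a) ≤ s → # (T a) ≤ # (λ b → R b ∧ T a b) + s
    neighbours-in-R a r few = begin
      # (T a)                                                ≤⟨ #-mono split ⟩
      # (λ b → (R b ∧ T a b) ∨ blocked b)                    ≤⟨ #-∨≤ _ blocked ⟩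
      # (λ b → R b ∧ T a b) + # blocked                      ≤⟨ +-monoʳ-≤ (# (λ b → R b ∧ T a b)) (≤-trans (#-image f {mate a} {blocked} cover) few) ⟩
      # (λ b → R b ∧ T a b) + s                              ∎
      where
      open ≤-Reasoning
      blocked : Fin N → Bool
      blocked b = anyᵇ (λ a' → mate a a' ∧ fibre f b a')
      cover : ∀ b → blocked b ≡ true → ∃ λ a' → mate a a' ≡ true × fibre f b a' ≡ true
      cover b e with anyᵇ-elim (λ a' → mate a a' ∧ fibre f b a') e
      ... | a' , h = a' , ∧-elimˡ h , ∧-elimʳ {mate a a'} h
      split : ∀ b → T a b ≡ true → (R b ∧ T a b) ∨ blocked b ≡ true
      split b Tab with blocked b in eq
      ... | true  = ∨-introʳ {R b ∧ T a b} refl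
      -- With no mate of `a` in its fibre, `b` is compatible with `a`, and closedness puts it into
      -- `R`.
      ... | false = ∨-introˡ (∧-intro (closed a r b (Tab , λ a' e → ¬-not (λ m →
                      contradiction (trans (≡-sym (anyᵇ-intro (λ a' → mate a a' ∧ fibre f b a') a' (∧-intro m e))) eq) λ ()))) Tab)

-- Degree sums, the dense subgraph and the contraction of stars.

<ᵇ-true : ∀ {i j} → i < j → (i <ᵇ j) ≡ true
<ᵇ-true = Equivalence.to T-≡ ∘ <⇒<ᵇ

-- `edges` counts each edge at its pair with the smaller index first. An ordered adjacent pair is
-- counted in one of the two orientations, and the diagonal contributes nothing by `irrefl`.
degree-sum≤2edges : (G : Graph) → sum (λ u → # (adj G u)) ≤ 2 * edges G
degree-sum≤2edges G = begin
  sum (λ u → # (adj G u))                                  ≤⟨ sum-mono (λ u → sum-mono (oriented u)) ⟩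
  sum (λ u → sum (λ v → up u v + up v u))                  ≡⟨ sum-cong-≗ (λ u → ∑-distrib-+ (up u) (λ v → up v u)) ⟩
  sum (λ u → sum (up u) + sum (λ v → up v u))              ≡⟨ ∑-distrib-+ (λ u → sum (up u)) (λ u → sum (λ v → up v u)) ⟩
  sum (λ u → sum (up u)) + sum (λ u → sum (λ v → up v u))  ≡⟨ cong (sum (λ u → sum (up u)) +_) (∑-comm (λ u v → up v u)) ⟩
  sum (λ u → sum (up u)) + sum (λ v → sum (up v))          ≡⟨ cong₂ _+_ edges≡ (trans edges≡ (≡-sym (+-identityʳ (edges G)))) ⟩
  2 * edges G                                              ∎
  where
  open ≤-Reasoning
  up : Fin (n G) → Fin (n G) → ℕ
  up u v = ι ((toℕ u <ᵇ toℕ v) ∧ adj G u v)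
  edges≡ : sum (λ u → sum (up u)) ≡ edges G
  edges≡ = ≡-sym (trans (sumᴸ≡sum (λ u → count (λ v → (toℕ u <ᵇ toℕ v) ∧ adj G u v)))
                        (sum-cong-≗ (λ u → count≡# (λ v → (toℕ u <ᵇ toℕ v) ∧ adj G u v))))
  oriented : ∀ u v → ι (adj G u v) ≤ up u v + up v u
  oriented u v with <-cmp (toℕ u) (toℕ v)
  ... | tri< u<v _ _ rewrite <ᵇ-true u<v = m≤m+n _ _
  ... | tri> _ _ v<u rewrite <ᵇ-true v<u | sym G v u = m≤n+m _ _
  ... | tri≈ _ u≡v _ rewrite toℕ-injective u≡v | irrefl G v = z≤n

#-elem : ∀ {k} {p : Fin k → Bool} (E : Enumeration p) (q : Fin k → Bool)
  → # (q ∘ Enumeration.elem E) ≡ # (λ b → p b ∧ q b)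
#-elem {p = p} E q = trans (Enumeration.sum-elem E (λ b → ι (q b))) (sum-cong-≗ (λ b → ≡-sym (ι-∧ (p b) (q b))))

-- The integral form of the first alternative, meant for `D = ⌈d₀⌉` and `suc s = ⌈ε₀ d₀⌉`.
DenseSubgraph : Graph → (s D : ℕ) → Set
DenseSubgraph G s D = Σ Graph λ H → IsSubgraphOf H G × n H ≤ D + suc s × suc s * suc s ≤ 2 * edges H

-- `dense` bounds the average degree below by `ℓ (D − s) − ℓ² s − 1`, with subtraction and division
-- cleared. `nonempty` guards against the default density 0 of the empty graph.
record DenseMinor (G : Graph) (ℓ s D : ℕ) : Set where
  field
    G'       : Graph
    nonempty : 0 < n G'
    minor    : IsBoundedMinorOf (ℓ + 1) G' G
    dense    : n G' * (ℓ * D) ≤ 2 * edges G' + n G' * (ℓ * s + ℓ * ℓ * s + 1)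

module Contraction (G : Graph) (side : Fin (n G) → Bool)
         (T : Fin (n G) → Fin (n G) → Bool)
         (T⊆adj : ∀ {a b} → T a b ≡ true → adj G a b ≡ true)
         (ℓ s : ℕ) where

  open Assignments T ℓ s

  -- `H` is induced on the kept neighbours of `a` together with a set `M` of `s + 1` mates. Each
  -- mate has at least `s + 1` neighbours among those of `a`, so the mates alone contribute
  -- `(s + 1)²` to the degree sum.
  many-mates⇒dense : ∀ {D} a → # (T a) ≤ D → s < # (mate a) → DenseSubgraph G s D
  many-mates⇒dense {D} a Ta≤D many with #-subset (mate a) (suc s) many
  ... | M , M⊆mate , #M = H , (elem , injective , λ _ _ e → e) , nH , eH
    where
    p : Fin (n G) → Bool
    p u = T a u ∨ M u
    E = enumerate p
    open Enumeration E
    H : Graph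
    H = record { n = size ; adj = λ i j → adj G (elem i) (elem j)
               ; sym = λ i j → sym G (elem i) (elem j) ; irrefl = λ i → irrefl G (elem i) }
    nH : size ≤ D + suc s
    nH = ≤-trans (≤-reflexive size≡#) (≤-trans (#-∨≤ (T a) M) (+-mono-≤ Ta≤D (≤-reflexive #M)))
    row : ∀ u → ι (M u) * suc s ≤ ι (p u) * # (λ v → p v ∧ adj G u v)
    row u with M u in eq
    ... | false = z≤n
    ... | true rewrite ∨-introʳ {T a u} {true} refl = +-mono-≤ (≤-trans (does-true (s <? common a u) (M⊆mate u eq))
             (#-mono (λ v e → ∧-intro (∨-introˡ (∧-elimˡ {T a v} e)) (T⊆adj (∧-elimʳ {T a v} e))))) z≤n
    eH : suc s * suc s ≤ 2 * edges H
    eH = begin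
      suc s * suc s                                          ≡⟨ cong (_* suc s) #M ⟨
      # M * suc s                                            ≡⟨ *-distribʳ-sum (suc s) (λ u → ι (M u)) ⟩
      sum (λ u → ι (M u) * suc s)                            ≤⟨ sum-mono row ⟩
      sum (λ u → ι (p u) * # (λ v → p v ∧ adj G u v))        ≡⟨ sum-elem (λ u → # (λ v → p v ∧ adj G u v)) ⟨
      sum (λ i → # (λ v → p v ∧ adj G (elem i) v))           ≡⟨ sum-cong-≗ (λ i → #-elem E (adj G (elem i))) ⟨
      sum (λ i → # (adj H i))                                ≤⟨ degree-sum≤2edges H ⟩
      2 * edges H                                            ∎
      where open ≤-Reasoning

  module Contract
         (T⊆A : ∀ {a b} → T a b ≡ true → side a ≡ true)
         (T⊆B : ∀ {a b} → T a b ≡ true → side b ≡ false)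
         {D : ℕ} (T-regular : ∀ a → side a ≡ true → # (T a) ≡ D) (s<D : s < D) (0<ℓ : 0 < ℓ)
         (few-mates : ∀ a → # (mate a) ≤ s) (S : Saturated side) where

    open Saturated S
    open Valid valid

    E = enumerate R
    open Enumeration E

    -- Kept edges run from A to B, so they join two stars only from a leaf of one to the centre of
    -- the other; `U` records one of the two directions and `adj'` both.
    U : Fin (n G) → Fin (n G) → Bool
    U b b' = anyᵇ (λ a → fibre f b a ∧ T a b')

    adj' : Fin (n G) → Fin (n G) → Bool
    adj' b b' = not (does (b ≟ b')) ∧ (U b b' ∨ U b' b)

    does-≟-sym : ∀ (b b' : Fin (n G)) → does (b ≟ b') ≡ does (b' ≟ b)
    does-≟-sym b b' with b ≟ b'
    ... | yes refl = ≡-sym (dec-true (b ≟ b) refl)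
    ... | no b≢b'  = ≡-sym (dec-false (b' ≟ b) (b≢b' ∘ ≡-sym))

    G' : Graph
    G' = record
      { n = size
      ; adj = λ i j → adj' (elem i) (elem j)
      ; sym = λ i j → cong₂ (λ x y → not x ∧ y) (does-≟-sym (elem i) (elem j)) (∨-comm (U (elem i) (elem j)) _)
      ; irrefl = λ i → cong (λ x → not x ∧ (U (elem i) (elem i) ∨ U (elem i) (elem i))) (dec-true (elem i ≟ elem i) refl)
      }

    star : Fin size → Fin (n G) → Bool
    star i u = does (elem i ≟ u) ∨ fibre f (elem i) u

    centre : ∀ i → star i (elem i) ≡ true
    centre i = ∨-introˡ (dec-true (elem i ≟ elem i) refl)

    leaf-adj : ∀ {a b} → fibre f b a ≡ true → adj G a b ≡ true
    leaf-adj e = T⊆adj (along e)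

    -- Since `0 < ℓ`, the full fibre of a centre is inhabited, and the kept edge from a leaf to the
    -- centre ends in B.
    elem-side : ∀ i → side (elem i) ≡ false
    elem-side i with #>0⇒∃ {p = fibre f (elem i)} (≤-trans 0<ℓ (≤-reflexive (≡-sym (full (elem i) (sound i)))))
    ... | a , e = T⊆B (along e)

    star-size : ∀ i → count (star i) ≤ ℓ + 1
    star-size i = begin
      count (star i)                                            ≡⟨ count≡# (star i) ⟩
      # (star i)                                                ≤⟨ #-∨≤ (λ u → does (elem i ≟ u)) (fibre f (elem i)) ⟩
      # (λ u → does (elem i ≟ u)) + # (fibre f (elem i))        ≡⟨ cong (_+ # (fibre f (elem i))) (#-≟ (elem i)) ⟩
      1 + # (fibre f (elem i))                                  ≤⟨ s≤s (small (elem i)) ⟩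
      1 + ℓ                                                     ≡⟨ +-comm 1 ℓ ⟩
      ℓ + 1                                                     ∎
      where open ≤-Reasoning

    from-centre : ∀ i v → star i v ≡ true → WalkIn G (star i) (elem i) v
    from-centre i v e with ∨-elim {does (elem i ≟ v)} e
    ... | inj₁ h rewrite ≡-sym (does-true (elem i ≟ v) h) = stay (elem i) (centre i)
    ... | inj₂ h = step (elem i) v v (centre i) (trans (sym G (elem i) v) (leaf-adj h)) (stay v e)

    connected : ∀ i → ConnectedIn G (star i)
    connected i u v eu ev with ∨-elim {does (elem i ≟ u)} eu
    ... | inj₁ h rewrite ≡-sym (does-true (elem i ≟ u) h) = from-centre i v ev
    ... | inj₂ h = step u (elem i) v eu (leaf-adj h) (from-centre i v ev)

    leaf≢centre : ∀ i {b} → fibre f b (elem i) ≢ true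
    leaf≢centre i e = contradiction (trans (≡-sym (T⊆A (along e))) (elem-side i)) λ ()

    -- Leaves lie in A and centres in B, so a shared vertex is the centre of both stars or a leaf of
    -- both; in the latter case the centres agree because `f` is single-valued.
    disjoint : ∀ i j → i ≢ j → ∀ u → star i u ≡ true → star j u ≡ false
    disjoint i j i≢j u eu = ¬-not λ ev → i≢j (injective (same (∨-elim {does (elem i ≟ u)} eu) (∨-elim {does (elem j ≟ u)} ev)))
      where
      just-injective : ∀ {b b'} → fibre f b u ≡ true → fibre f b' u ≡ true → b ≡ b'
      just-injective {b} {b'} e e' with f u
      ... | just c = trans (≡-sym (does-true (c ≟ b) e)) (does-true (c ≟ b') e')
      same : does (elem i ≟ u) ≡ true ⊎ fibre f (elem i) u ≡ true → does (elem j ≟ u) ≡ true ⊎ fibre f (elem j) u ≡ true → elem i ≡ elem j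
      same (inj₁ h) (inj₁ h') = trans (does-true (elem i ≟ u) h) (≡-sym (does-true (elem j ≟ u) h'))
      same (inj₁ h) (inj₂ h') rewrite ≡-sym (does-true (elem i ≟ u) h) = contradiction h' (leaf≢centre i)
      same (inj₂ h) (inj₁ h') rewrite ≡-sym (does-true (elem j ≟ u) h') = contradiction h (leaf≢centre j)
      same (inj₂ h) (inj₂ h') = just-injective h h'

    joined : ∀ i j → adj' (elem i) (elem j) ≡ true
      → Σ (Fin (n G)) λ u → Σ (Fin (n G)) λ v → star i u ≡ true × star j v ≡ true × adj G u v ≡ true
    joined i j e with ∨-elim {U (elem i) (elem j)} (∧-elimʳ {not (does (elem i ≟ elem j))} e)
    ... | inj₁ h with anyᵇ-elim _ h
    ...   | a , h' = a , elem j , ∨-introʳ {does (elem i ≟ a)} (∧-elimˡ h') , centre j , T⊆adj (∧-elimʳ {fibre f (elem i) a} h')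
    joined i j e | inj₂ h with anyᵇ-elim _ h
    ...   | a , h' = elem i , a , centre i , ∨-introʳ {does (elem j ≟ a)} (∧-elimˡ h')
                   , trans (sym G (elem i) a) (T⊆adj (∧-elimʳ {fibre f (elem j) a} h'))

    -- Each of the `ℓ` leaves at `b` has at least `D − s` kept neighbours in `R`, and two leaves
    -- share at most `s` as they are unmated. Passing to the union loses at most `ℓ * ℓ * s`, and
    -- one more is lost for `b` itself.
    degree : ∀ b → R b ≡ true → ℓ * D ≤ # (λ b' → R b' ∧ adj' b b') + (ℓ * s + ℓ * ℓ * s + 1)
    -- The enumeration of the fibre has a length `l` that is only propositionally equal to `ℓ`, so
    -- the bound is proved for `l` and transported.
    degree b Rb = subst (λ l → l * D ≤ # (λ b' → R b' ∧ adj' b b') + (l * s + l * l * s + 1)) (trans F.size≡# (full b Rb)) bound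
      where
      open ≤-Reasoning
      module F = Enumeration (enumerate (fibre f b))
      l = F.size
      g : Fin l → Fin (n G) → Bool
      g i b' = R b' ∧ T (F.elem i) b'
      deg = # (λ b' → R b' ∧ adj' b b')
      each : ∀ i → D ≤ # (g i) + s
      each i = ≤-trans (≤-reflexive (≡-sym (T-regular (F.elem i) (T⊆A (along (F.sound i))))))
        (neighbours-in-R S (F.elem i) (inj₂ (b , F.sound i , Rb)) (few-mates (F.elem i)))
      pair : ∀ i j → i ≢ j → # (λ b' → g i b' ∧ g j b') ≤ s
      pair i j i≢j = ≤-trans
        (#-mono (λ b' e → ∧-intro (∧-elimʳ {R b'} (∧-elimˡ e)) (∧-elimʳ {R b'} (∧-elimʳ {g i b'} e))))
        (unmated⇒common≤ (F.elem i) (F.elem j) (unmated (i≢j ∘ F.injective) (F.sound i) (F.sound j)))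
      covered : ∀ b' → anyᵇ (λ i → g i b') ≡ true → (R b' ∧ adj' b b') ∨ does (b ≟ b') ≡ true
      covered b' e with anyᵇ-elim (λ i → g i b') e
      ... | i , h with b ≟ b'
      -- Here the kept neighbour `b'` is the centre `b` itself, the origin of the summand 1.
      ...   | yes _ = ∨-introʳ {R b' ∧ _} refl
      ...   | no  _ = ∨-introˡ (∧-intro (∧-elimˡ {R b'} h) (∨-introˡ
                (anyᵇ-intro (λ a → fibre f b a ∧ T a b') (F.elem i) (∧-intro (F.sound i) (∧-elimʳ {R b'} h)))))
      union : # (λ b' → anyᵇ (λ i → g i b')) ≤ deg + 1
      union = ≤-trans (#-mono covered) (≤-trans (#-∨≤ (λ b' → R b' ∧ adj' b b') (λ b' → does (b ≟ b')))
                (≤-reflexive (cong (deg +_) (#-≟ b))))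
      bound : l * D ≤ deg + (l * s + l * l * s + 1)
      bound = begin
        l * D                                                    ≡⟨ sum-const {l} D ⟨
        sum {l} (const D)                                        ≤⟨ sum-mono each ⟩
        sum (λ i → # (g i) + s)                                  ≡⟨ ∑-distrib-+ (λ i → # (g i)) (const s) ⟩
        sum (λ i → # (g i)) + sum {l} (const s)                  ≡⟨ cong (sum (λ i → # (g i)) +_) (sum-const {l} s) ⟩
        sum (λ i → # (g i)) + l * s                              ≤⟨ +-monoˡ-≤ (l * s) (sum-#≤#-anyᵇ s g pair) ⟩
        # (λ b' → anyᵇ (λ i → g i b')) + l * l * s + l * s       ≤⟨ +-monoˡ-≤ (l * s) (+-monoˡ-≤ (l * l * s) union) ⟩
        deg + 1 + l * l * s + l * s                              ≡⟨ solve 3 (λ d x y → d :+ con 1 :+ x :+ y := d :+ (y :+ x :+ con 1)) refl deg (l * l * s) (l * s) ⟩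
        deg + (l * s + l * l * s + 1)                            ∎
        where open ℕ-Solver

    -- `a₀` has `D > s` kept neighbours, of which at most `s` lie outside `R`.
    R-nonempty : 0 < size
    R-nonempty = ≤-trans (+-cancelʳ-< s 0 _ (<-≤-trans s<D (≤-trans (≤-reflexive (≡-sym (T-regular a₀ a₀∈A)))
        (neighbours-in-R S a₀ (inj₁ refl) (few-mates a₀)))))
      (≤-trans (#-mono {p = λ b → R b ∧ T a₀ b} {R} (λ b e → ∧-elimˡ e)) (≤-reflexive (≡-sym size≡#)))

    many-edges : size * (ℓ * D) ≤ 2 * edges G' + size * (ℓ * s + ℓ * ℓ * s + 1)
    many-edges = begin
      size * (ℓ * D)                                                ≡⟨ sum-const {size} (ℓ * D) ⟨
      sum {size} (const (ℓ * D))                                    ≤⟨ sum-mono (λ i → degree (elem i) (sound i)) ⟩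
      sum (λ i → # (λ b → R b ∧ adj' (elem i) b) + C)               ≡⟨ ∑-distrib-+ (λ i → # (λ b → R b ∧ adj' (elem i) b)) (const C) ⟩
      sum (λ i → # (λ b → R b ∧ adj' (elem i) b)) + sum {size} (const C)
        ≡⟨ cong₂ _+_ (≡-sym (sum-cong-≗ (λ i → #-elem E (adj' (elem i))))) (sum-const {size} C) ⟩
      sum (λ i → # (adj G' i)) + size * C                           ≤⟨ +-monoˡ-≤ (size * C) (degree-sum≤2edges G') ⟩
      2 * edges G' + size * C                                       ∎
      where
      open ≤-Reasoning
      C = ℓ * s + ℓ * ℓ * s + 1

    contracted : DenseMinor G ℓ s D
    contracted = record
      { G' = G' ; nonempty = R-nonempty
      ; minor = star , (λ i → elem i , centre i) , star-size , connected , disjoint , joined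
      ; dense = many-edges }

dense-subgraph-or-minor : (G : Graph) (side : Fin (n G) → Bool) (ℓ s D : ℕ) → 0 < ℓ → s < D
  → ℓ * count (λ v → not (side v)) < count side
  → (∀ a → side a ≡ true → D ≤ degInB G side a)
  → DenseSubgraph G s D ⊎ DenseMinor G ℓ s D
dense-subgraph-or-minor G side ℓ s D 0<ℓ s<D large degrees = conclude (any? (λ a → s <? # (mate a)))
  where
  -- Keeping exactly `D` neighbours bounds the order of the dense subgraph from above and the
  -- degrees towards `R` from below.
  truncate : ∀ a → Σ (Fin (n G) → Bool) λ q → (∀ b → q b ≡ true → side a ≡ true × not (side b) ∧ adj G a b ≡ true)
                 × # q ≤ D × (side a ≡ true → # q ≡ D)
  truncate a with side a in eq
  -- Vertices outside A get an empty row, so `T` starts only in A and no such vertex has mates.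
  ... | false = const false , (λ _ ()) , ≤-trans (≤-reflexive (#-none {p = λ (_ : Fin (n G)) → false} (λ _ → refl))) z≤n , λ ()
  ... | true with #-subset (λ b → not (side b) ∧ adj G a b) D
                    (≤-trans (degrees a eq) (≤-reflexive (count≡# (λ b → not (side b) ∧ adj G a b))))
  ...   | q , q⊆ , #q = q , (λ b e → refl , q⊆ b e) , ≤-reflexive #q , λ _ → #q
  T : Fin (n G) → Fin (n G) → Bool
  T a = proj₁ (truncate a)
  T⊆A : ∀ {a b} → T a b ≡ true → side a ≡ true
  T⊆A {a} {b} e = proj₁ (proj₁ (proj₂ (truncate a)) b e)
  T⊆ : ∀ {a b} → T a b ≡ true → not (side b) ∧ adj G a b ≡ true
  T⊆ {a} {b} e = proj₂ (proj₁ (proj₂ (truncate a)) b e)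
  T⊆adj : ∀ {a b} → T a b ≡ true → adj G a b ≡ true
  T⊆adj {a} {b} e = ∧-elimʳ {not (side b)} (T⊆ e)
  T⊆B : ∀ {a b} → T a b ≡ true → side b ≡ false
  T⊆B e = trans (≡-sym (not-involutive _)) (cong not (∧-elimˡ (T⊆ e)))
  open Assignments T ℓ s
  open Contraction G side T T⊆adj ℓ s
  large# : ℓ * # (λ v → not (side v)) < # side
  large# = subst₂ (λ x y → ℓ * x < y) (count≡# (λ v → not (side v))) (count≡# side) large
  conclude : Dec (∃ λ a → s < # (mate a)) → DenseSubgraph G s D ⊎ DenseMinor G ℓ s D
  conclude (yes (a , many)) = inj₁ (many-mates⇒dense a (proj₁ (proj₂ (proj₂ (truncate a)))) many)
  conclude (no none) = inj₂ (Contract.contracted T⊆A T⊆B (λ a → proj₂ (proj₂ (proj₂ (truncate a)))) s<D 0<ℓ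
                  (λ a → ≮⇒≥ (λ lt → none (a , lt)))
                  (saturate side (λ v → not (side v)) (λ e → ∧-elimˡ (T⊆ e)) large#))

-- Transfer from natural numbers to rationals, and the numerical estimates.

toℚᵘ-ℕ→ℚ : ∀ k → toℚᵘ (ℕ→ℚ k) ≃ᵘ mkℚᵘ (ℤ.+ k) 0
toℚᵘ-ℕ→ℚ k = ℚ.toℚᵘ-fromℚᵘ (mkℚᵘ (ℤ.+ k) 0)

-- `ℕ→ℚ` normalises by a gcd and does not reduce on variables, so the identity is checked on
-- unnormalised fractions and reflected by injectivity of `toℚᵘ`.
ℕ→ℚ-+ : ∀ i j → ℕ→ℚ (i + j) ≡ ℕ→ℚ i +ℚ ℕ→ℚ j
ℕ→ℚ-+ i j = ℚ.toℚᵘ-injective (begin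
  toℚᵘ (ℕ→ℚ (i + j))                 ≈⟨ toℚᵘ-ℕ→ℚ (i + j) ⟩
  mkℚᵘ (ℤ.+ (i + j)) 0                 ≈⟨ *≡* (cong (ℤ._* ℤ.+ 1) (cong₂ ℤ._+_ (≡-sym (ℤ.*-identityʳ (ℤ.+ i))) (≡-sym (ℤ.*-identityʳ (ℤ.+ j))))) ⟩
  mkℚᵘ (ℤ.+ i) 0 +ᵘ mkℚᵘ (ℤ.+ j) 0       ≈⟨ ℚᵘ.+-cong (toℚᵘ-ℕ→ℚ i) (toℚᵘ-ℕ→ℚ j) ⟨
  toℚᵘ (ℕ→ℚ i) +ᵘ toℚᵘ (ℕ→ℚ j)       ≈⟨ ℚ.toℚᵘ-homo-+ (ℕ→ℚ i) (ℕ→ℚ j) ⟨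
  toℚᵘ (ℕ→ℚ i +ℚ ℕ→ℚ j)              ∎)
  where open ℚᵘ.≃-Reasoning

ℕ→ℚ-* : ∀ i j → ℕ→ℚ (i * j) ≡ ℕ→ℚ i *ℚ ℕ→ℚ j
ℕ→ℚ-* i j = ℚ.toℚᵘ-injective (begin
  toℚᵘ (ℕ→ℚ (i * j))                 ≈⟨ toℚᵘ-ℕ→ℚ (i * j) ⟩
  mkℚᵘ (ℤ.+ (i * j)) 0                 ≈⟨ *≡* (cong (ℤ._* ℤ.+ 1) (ℤ.pos-* i j)) ⟩
  mkℚᵘ (ℤ.+ i) 0 *ᵘ mkℚᵘ (ℤ.+ j) 0       ≈⟨ ℚᵘ.*-cong (toℚᵘ-ℕ→ℚ i) (toℚᵘ-ℕ→ℚ j) ⟨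
  toℚᵘ (ℕ→ℚ i) *ᵘ toℚᵘ (ℕ→ℚ j)       ≈⟨ ℚ.toℚᵘ-homo-* (ℕ→ℚ i) (ℕ→ℚ j) ⟨
  toℚᵘ (ℕ→ℚ i *ℚ ℕ→ℚ j)              ∎)
  where open ℚᵘ.≃-Reasoning

ℕ→ℚ-mono-≤ : ∀ {i j} → i ≤ j → ℕ→ℚ i ≤ℚ ℕ→ℚ j
ℕ→ℚ-mono-≤ {i} {j} i≤j = ℚ.toℚᵘ-cancel-≤ (begin
  toℚᵘ (ℕ→ℚ i)       ≃⟨ toℚᵘ-ℕ→ℚ i ⟩
  mkℚᵘ (ℤ.+ i) 0       ≤⟨ *≤* (ℤ.*-monoʳ-≤-nonNeg (ℤ.+ 1) (ℤ.+≤+ i≤j)) ⟩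
  mkℚᵘ (ℤ.+ j) 0       ≃⟨ toℚᵘ-ℕ→ℚ j ⟨
  toℚᵘ (ℕ→ℚ j)       ∎)
  where open ℚᵘ.≤-Reasoning

ℕ→ℚ-cancel-< : ∀ {i j} → ℕ→ℚ i <ℚ ℕ→ℚ j → i < j
ℕ→ℚ-cancel-< lt = ℕ.≰⇒> λ j≤i → contradiction (ℚ.<-≤-trans lt (ℕ→ℚ-mono-≤ j≤i)) (ℚ.<-irrefl refl)

/-*-cancel : ∀ e m → (ℤ.+ e /ℚ suc m) *ℚ ℕ→ℚ (suc m) ≡ ℕ→ℚ e
/-*-cancel e m = ℚ.toℚᵘ-injective (begin
  toℚᵘ ((ℤ.+ e /ℚ suc m) *ℚ ℕ→ℚ (suc m))             ≈⟨ ℚ.toℚᵘ-homo-* (ℤ.+ e /ℚ suc m) (ℕ→ℚ (suc m)) ⟩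
  toℚᵘ (ℤ.+ e /ℚ suc m) *ᵘ toℚᵘ (ℕ→ℚ (suc m))        ≈⟨ ℚᵘ.*-cong (ℚ.toℚᵘ-fromℚᵘ (mkℚᵘ (ℤ.+ e) m)) (toℚᵘ-ℕ→ℚ (suc m)) ⟩
  mkℚᵘ (ℤ.+ e) m *ᵘ mkℚᵘ (ℤ.+ suc m) 0                 ≈⟨ *≡* (trans (ℤ.*-identityʳ _) (cong (λ z → ℤ.+ e ℤ.* ℤ.+ z) (≡-sym (ℕ.*-identityʳ (suc m))))) ⟩
  mkℚᵘ (ℤ.+ e) 0                                     ≈⟨ toℚᵘ-ℕ→ℚ e ⟨
  toℚᵘ (ℕ→ℚ e)                                     ∎)
  where open ℚᵘ.≃-Reasoning

-- `suc m` is the ceiling of `q`, found by descending from a known upper bound; positivity of `q`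
-- stops the descent before 0.
ceiling : ∀ bound q → 0ℚ <ℚ q → q ≤ℚ ℕ→ℚ bound → ∃ λ m → ℕ→ℚ m <ℚ q × q ≤ℚ ℕ→ℚ (suc m)
ceiling zero    q 0<q q≤0 = contradiction (ℚ.<-≤-trans 0<q q≤0) (ℚ.<-irrefl refl)
ceiling (suc b) q 0<q q≤ with ℕ→ℚ b ℚ.<? q
... | yes b<q = b , b<q , q≤
... | no  b≮q = ceiling b q 0<q (ℚ.≮⇒≥ b≮q)

density≥ : ∀ G q → 0 < n G → q *ℚ ℕ→ℚ (n G) ≤ℚ ℕ→ℚ (edges G) → q ≤ℚ density G
density≥ G@record { n = suc m } q pos le =
  ℚ.*-cancelʳ-≤-pos (ℕ→ℚ (suc m)) {{positive (ℚ.<-≤-trans (ℚ.positive⁻¹ 1ℚ) (ℕ→ℚ-mono-≤ {1} {suc m} (s≤s z≤n)))}}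
    (ℚ.≤-trans le (ℚ.≤-reflexive (≡-sym (/-*-cancel (edges G) m))))

0≤ℕ→ℚ : ∀ k → 0ℚ ≤ℚ ℕ→ℚ k
0≤ℕ→ℚ k = ℕ→ℚ-mono-≤ {0} {k} z≤n

*-mono-≤-nonNeg : ∀ {p q r t} → 0ℚ ≤ℚ p → 0ℚ ≤ℚ t → p ≤ℚ q → r ≤ℚ t → p *ℚ r ≤ℚ q *ℚ t
*-mono-≤-nonNeg {p} {q} {r} {t} 0≤p 0≤t p≤q r≤t =
  ℚ.≤-trans (ℚ.*-monoˡ-≤-nonNeg p {{nonNegative 0≤p}} r≤t) (ℚ.*-monoʳ-≤-nonNeg t {{nonNegative 0≤t}} p≤q)

+-cancelʳ-≤ : ∀ r {p q} → p +ℚ r ≤ℚ q +ℚ r → p ≤ℚ q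
+-cancelʳ-≤ r {p} {q} le = subst₂ _≤ℚ_ (cancel p r) (cancel q r) (ℚ.+-monoˡ-≤ (0ℚ -ℚ r) le)
  where
  open ℚ-Solver
  cancel : ∀ p r → p +ℚ r +ℚ (0ℚ -ℚ r) ≡ p
  cancel = solve 2 (λ p r → p :+ r :+ (con 0ℚ :- r) := p) refl

-- δ stands for ε₀ d₀.

subgraph-order : ∀ {D s d δ} → D ≤ℚ d → s ≤ℚ δ → 1ℚ ≤ℚ δ → ℕ→ℚ 4 *ℚ δ ≤ℚ d → 0ℚ ≤ℚ d
  → (1ℚ +ℚ D) +ℚ (1ℚ +ℚ s) ≤ℚ ℕ→ℚ 3 *ℚ d
subgraph-order {D} {s} {d} {δ} D≤d s≤δ 1≤δ 4δ≤d 0≤d = begin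
  (1ℚ +ℚ D) +ℚ (1ℚ +ℚ s)          ≤⟨ ℚ.+-mono-≤ (ℚ.+-mono-≤ 1≤δ D≤d) (ℚ.+-mono-≤ 1≤δ s≤δ) ⟩
  (δ +ℚ d) +ℚ (δ +ℚ δ)            ≡⟨ ℚ.+-identityʳ _ ⟨
  -- A fourth `δ` is added so that `4 δ ≤ d` applies; a further zero then grows into the third `d`.
  (δ +ℚ d) +ℚ (δ +ℚ δ) +ℚ 0ℚ      ≤⟨ ℚ.+-monoʳ-≤ ((δ +ℚ d) +ℚ (δ +ℚ δ)) (ℚ.≤-trans (ℚ.nonNegative⁻¹ 1ℚ) 1≤δ) ⟩
  (δ +ℚ d) +ℚ (δ +ℚ δ) +ℚ δ       ≡⟨ solve 2 (λ δ d → (δ :+ d) :+ (δ :+ δ) :+ δ := d :+ con (ℕ→ℚ 4) :* δ :+ con 0ℚ) refl δ d ⟩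
  d +ℚ ℕ→ℚ 4 *ℚ δ +ℚ 0ℚ           ≤⟨ ℚ.+-mono-≤ (ℚ.+-monoʳ-≤ d 4δ≤d) 0≤d ⟩
  d +ℚ d +ℚ d                     ≡⟨ solve 1 (λ d → d :+ d :+ d := con (ℕ→ℚ 3) :* d) refl d ⟩
  ℕ→ℚ 3 *ℚ d                      ∎
  where
  open ℚ.≤-Reasoning
  open ℚ-Solver

subgraph-edges : ∀ {δ s E} → 0ℚ ≤ℚ δ → δ ≤ℚ s → s *ℚ s ≤ℚ ℕ→ℚ 2 *ℚ E → δ *ℚ δ *ℚ ½ ≤ℚ E
subgraph-edges {δ} {s} {E} 0≤δ δ≤s le = begin
  δ *ℚ δ *ℚ ½              ≤⟨ ℚ.*-monoʳ-≤-nonNeg ½ (*-mono-≤-nonNeg 0≤δ (ℚ.≤-trans 0≤δ δ≤s) δ≤s δ≤s) ⟩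
  s *ℚ s *ℚ ½              ≤⟨ ℚ.*-monoʳ-≤-nonNeg ½ le ⟩
  ℕ→ℚ 2 *ℚ E *ℚ ½          ≡⟨ solve 1 (λ E → con (ℕ→ℚ 2) :* E :* con ½ := E) refl E ⟩
  E                        ∎
  where
  open ℚ.≤-Reasoning
  open ℚ-Solver

-- Write `δ` for `ε d`. The loss is at most `(ℓ + ℓ² + 1) δ` because `s ≤ δ` and `1 ≤ δ`, and
-- `ℓ + 1 ≤ ℓ²` bounds this by `2 ℓ² δ`, exactly the difference between `ℓ d` and `ℓ (1 − 2 ℓ ε) d`.
minor-edges : ∀ {ℓ ε d D s m E} → 0ℚ ≤ℚ ℓ → ℓ +ℚ 1ℚ ≤ℚ ℓ *ℚ ℓ → 0ℚ ≤ℚ m → d ≤ℚ D → s ≤ℚ ε *ℚ d → 1ℚ ≤ℚ ε *ℚ d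
  → m *ℚ (ℓ *ℚ D) ≤ℚ ℕ→ℚ 2 *ℚ E +ℚ m *ℚ (ℓ *ℚ s +ℚ ℓ *ℚ ℓ *ℚ s +ℚ 1ℚ)
  → (ℓ *ℚ ½) *ℚ (1ℚ -ℚ (ℕ→ℚ 2 *ℚ ℓ) *ℚ ε) *ℚ d *ℚ m ≤ℚ E
minor-edges {ℓ} {ε} {d} {D} {s} {m} {E} 0≤ℓ ℓ+1≤ℓ² 0≤m d≤D s≤δ 1≤δ le = begin
  (ℓ *ℚ ½) *ℚ (1ℚ -ℚ (ℕ→ℚ 2 *ℚ ℓ) *ℚ ε) *ℚ d *ℚ m
    ≡⟨ solve 4 (λ ℓ ε d m → (ℓ :* con ½) :* (con 1ℚ :- (con (ℕ→ℚ 2) :* ℓ) :* ε) :* d :* m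
                 := m :* (ℓ :* (con 1ℚ :- (con (ℕ→ℚ 2) :* ℓ) :* ε) :* d) :* con ½) refl ℓ ε d m ⟩
  m *ℚ X *ℚ ½              ≤⟨ ℚ.*-monoʳ-≤-nonNeg ½ (+-cancelʳ-≤ (m *ℚ C) {m *ℚ X} {ℕ→ℚ 2 *ℚ E} twice) ⟩
  ℕ→ℚ 2 *ℚ E *ℚ ½          ≡⟨ solve 1 (λ E → con (ℕ→ℚ 2) :* E :* con ½ := E) refl E ⟩
  E                        ∎
  where
  open ℚ.≤-Reasoning
  open ℚ-Solver
  δ = ε *ℚ d
  X = ℓ *ℚ (1ℚ -ℚ (ℕ→ℚ 2 *ℚ ℓ) *ℚ ε) *ℚ d
  C = ℓ *ℚ s +ℚ ℓ *ℚ ℓ *ℚ s +ℚ 1ℚ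
  0≤δ : 0ℚ ≤ℚ δ
  0≤δ = ℚ.≤-trans (ℚ.nonNegative⁻¹ 1ℚ) 1≤δ
  0≤ℓ² : 0ℚ ≤ℚ ℓ *ℚ ℓ
  0≤ℓ² = ℚ.≤-trans (ℚ.≤-trans 0≤ℓ (ℚ.≤-trans (ℚ.≤-reflexive (≡-sym (ℚ.+-identityʳ ℓ))) (ℚ.+-monoʳ-≤ ℓ (ℚ.nonNegative⁻¹ 1ℚ)))) ℓ+1≤ℓ²
  X+C≤ℓD : X +ℚ C ≤ℚ ℓ *ℚ D
  X+C≤ℓD = begin
    X +ℚ C
      ≤⟨ ℚ.+-monoʳ-≤ X (ℚ.+-mono-≤ (ℚ.+-mono-≤ (ℚ.*-monoˡ-≤-nonNeg ℓ {{nonNegative 0≤ℓ}} s≤δ)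
           (ℚ.*-monoˡ-≤-nonNeg (ℓ *ℚ ℓ) {{nonNegative 0≤ℓ²}} s≤δ)) 1≤δ) ⟩
    X +ℚ (ℓ *ℚ δ +ℚ ℓ *ℚ ℓ *ℚ δ +ℚ δ)
      ≡⟨ solve 3 (λ ℓ ε d → ℓ :* (con 1ℚ :- (con (ℕ→ℚ 2) :* ℓ) :* ε) :* d :+ (ℓ :* (ε :* d) :+ ℓ :* ℓ :* (ε :* d) :+ ε :* d)
                   := ℓ :* d :- ℓ :* ℓ :* (ε :* d) :+ (ℓ :+ con 1ℚ) :* (ε :* d)) refl ℓ ε d ⟩
    ℓ *ℚ d -ℚ ℓ *ℚ ℓ *ℚ δ +ℚ (ℓ +ℚ 1ℚ) *ℚ δ
      ≤⟨ ℚ.+-monoʳ-≤ (ℓ *ℚ d -ℚ ℓ *ℚ ℓ *ℚ δ) (ℚ.*-monoʳ-≤-nonNeg δ {{nonNegative 0≤δ}} ℓ+1≤ℓ²) ⟩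
    ℓ *ℚ d -ℚ ℓ *ℚ ℓ *ℚ δ +ℚ ℓ *ℚ ℓ *ℚ δ
      ≡⟨ solve 2 (λ x y → x :- y :+ y := x) refl (ℓ *ℚ d) (ℓ *ℚ ℓ *ℚ δ) ⟩
    ℓ *ℚ d
      ≤⟨ ℚ.*-monoˡ-≤-nonNeg ℓ {{nonNegative 0≤ℓ}} d≤D ⟩
    ℓ *ℚ D ∎
  twice : m *ℚ X +ℚ m *ℚ C ≤ℚ ℕ→ℚ 2 *ℚ E +ℚ m *ℚ C
  twice = begin
    m *ℚ X +ℚ m *ℚ C             ≡⟨ ℚ.*-distribˡ-+ m X C ⟨
    m *ℚ (X +ℚ C)                ≤⟨ ℚ.*-monoˡ-≤-nonNeg m {{nonNegative 0≤m}} X+C≤ℓD ⟩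
    m *ℚ (ℓ *ℚ D)                ≤⟨ le ⟩
    ℕ→ℚ 2 *ℚ E +ℚ m *ℚ C         ∎

-- Rounding of `d₀` and `ε₀ d₀` to integers.

theorem4p2 : (ℓ : ℕ) → 2 ≤ ℓ → (ε₀ d₀ : ℚ)
    → 0ℚ <ℚ ε₀ → ℕ→ℚ (2 * ℓ) *ℚ ε₀ <ℚ 1ℚ → 1ℚ ≤ℚ ε₀ *ℚ d₀
    → (G : Graph) → (side : Fin (n G) → Bool) → IsBipartition G side
    → ℓ * count (λ v → not (side v)) < count side
    → (∀ a → side a ≡ true → d₀ ≤ℚ ℕ→ℚ (degInB G side a))
    → (Σ Graph λ H → IsSubgraphOf H G
    × ℕ→ℚ (n H) ≤ℚ ℕ→ℚ 3 *ℚ d₀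
    × (ε₀ *ℚ ε₀) *ℚ (d₀ *ℚ d₀) *ℚ ½ ≤ℚ ℕ→ℚ (edges H))
    ⊎ (Σ Graph λ G' → IsBoundedMinorOf (ℓ + 1) G' G
    × (ℕ→ℚ ℓ *ℚ ½) *ℚ (1ℚ -ℚ ℕ→ℚ (2 * ℓ) *ℚ ε₀) *ℚ d₀ ≤ℚ density G')
theorem4p2 ℓ 2≤ℓ ε d 0<ε 2ℓε<1 1≤δ G side _ large degrees
  = conclude (ceiling (proj₁ d-bound) d 0<d (proj₂ d-bound)) (ceiling (proj₁ d-bound) δ 0<δ (ℚ.≤-trans δ≤d (proj₂ d-bound)))
  where
  open ℚ-Solver
  δ = ε *ℚ d
  0<δ : 0ℚ <ℚ δ
  0<δ = ℚ.<-≤-trans (ℚ.positive⁻¹ 1ℚ) 1≤δ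
  0<d : 0ℚ <ℚ d
  0<d = ℚ.*-cancelˡ-<-nonNeg ε {{nonNegative (ℚ.<⇒≤ 0<ε)}} (subst (_<ℚ δ) (≡-sym (ℚ.*-zeroʳ ε)) 0<δ)
  -- The constant comes from `4 ε ≤ 2 ℓ ε < 1`, by `2 ≤ ℓ`.
  4δ≤d : ℕ→ℚ 4 *ℚ δ ≤ℚ d
  4δ≤d = begin
    ℕ→ℚ 4 *ℚ (ε *ℚ d)          ≤⟨ ℚ.*-monoʳ-≤-nonNeg δ {{nonNegative (ℚ.<⇒≤ 0<δ)}} (ℕ→ℚ-mono-≤ {4} {2 * ℓ} (ℕ.*-monoʳ-≤ 2 2≤ℓ)) ⟩
    ℕ→ℚ (2 * ℓ) *ℚ (ε *ℚ d)    ≡⟨ ℚ.*-assoc (ℕ→ℚ (2 * ℓ)) ε d ⟨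
    ℕ→ℚ (2 * ℓ) *ℚ ε *ℚ d      ≤⟨ ℚ.*-monoʳ-≤-nonNeg d {{nonNegative (ℚ.<⇒≤ 0<d)}} (ℚ.<⇒≤ 2ℓε<1) ⟩
    1ℚ *ℚ d                    ≡⟨ ℚ.*-identityˡ d ⟩
    d                          ∎
    where open ℚ.≤-Reasoning
  δ≤d : δ ≤ℚ d
  δ≤d = ℚ.≤-trans (ℚ.≤-reflexive (≡-sym (ℚ.*-identityˡ δ)))
          (ℚ.≤-trans (ℚ.*-monoʳ-≤-nonNeg δ {{nonNegative (ℚ.<⇒≤ 0<δ)}} (ℕ→ℚ-mono-≤ {1} {4} (s≤s z≤n))) 4δ≤d)
  -- A is nonempty because `count side` exceeds a natural number; the degree of one of its vertices
  -- is an integer bound on `d`, and both ceilings are sought below it.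
  d-bound : ∃ λ k → d ≤ℚ ℕ→ℚ k
  d-bound = degInB G side (proj₁ some-a) , degrees (proj₁ some-a) (proj₂ some-a)
    where
    some-a = #>0⇒∃ {p = side} (ℕ.≤-<-trans z≤n (subst (ℓ * count (λ v → not (side v)) <_) (count≡# side) large))
  -- The chain is `ℓ + 1 ≤ 2 ℓ ≤ ℓ²`, whose last inequality fails for `ℓ = 1`.
  ℓ+1≤ℓ² : ℕ→ℚ ℓ +ℚ 1ℚ ≤ℚ ℕ→ℚ ℓ *ℚ ℕ→ℚ ℓ
  ℓ+1≤ℓ² = subst₂ _≤ℚ_ (ℕ→ℚ-+ ℓ 1) (ℕ→ℚ-* ℓ ℓ) (ℕ→ℚ-mono-≤ {ℓ + 1} {ℓ * ℓ}
    (ℕ.≤-trans (ℕ.+-monoʳ-≤ ℓ (ℕ.≤-trans (s≤s z≤n) 2≤ℓ)) (ℕ.≤-trans (ℕ.≤-reflexive (cong (λ x → ℓ + x) (≡-sym (ℕ.+-identityʳ ℓ)))) (ℕ.*-monoˡ-≤ ℓ 2≤ℓ))))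
  Outcome-i Outcome-ii : Set
  Outcome-i = Σ Graph λ H → IsSubgraphOf H G × ℕ→ℚ (n H) ≤ℚ ℕ→ℚ 3 *ℚ d × (ε *ℚ ε) *ℚ (d *ℚ d) *ℚ ½ ≤ℚ ℕ→ℚ (edges H)
  Outcome-ii = Σ Graph λ G' → IsBoundedMinorOf (ℓ + 1) G' G
    × (ℕ→ℚ ℓ *ℚ ½) *ℚ (1ℚ -ℚ ℕ→ℚ (2 * ℓ) *ℚ ε) *ℚ d ≤ℚ density G'
  -- `D` and `s` are one below the two ceilings, so the combinatorial statement is applied to
  -- `suc D` and to `s` itself.
  module Rounded (D s : ℕ) (D<d : ℕ→ℚ D <ℚ d) (d≤1+D : d ≤ℚ ℕ→ℚ (suc D)) (s<δ : ℕ→ℚ s <ℚ δ) (δ≤1+s : δ ≤ℚ ℕ→ℚ (suc s)) where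
    subgraph : DenseSubgraph G s (suc D) → Outcome-i
    subgraph (H , H⊆G , nH , eH) = H , H⊆G
      , ℚ.≤-trans (ℕ→ℚ-mono-≤ {n H} {suc D + suc s} nH) (subst (_≤ℚ ℕ→ℚ 3 *ℚ d)
          (≡-sym (trans (ℕ→ℚ-+ (suc D) (suc s)) (cong₂ _+ℚ_ (ℕ→ℚ-+ 1 D) (ℕ→ℚ-+ 1 s))))
          (subgraph-order {ℕ→ℚ D} {ℕ→ℚ s} {d} {δ} (ℚ.<⇒≤ D<d) (ℚ.<⇒≤ s<δ) 1≤δ 4δ≤d (ℚ.<⇒≤ 0<d)))
      , subst (λ x → x *ℚ ½ ≤ℚ ℕ→ℚ (edges H))
          (solve 2 (λ ε d → (ε :* d) :* (ε :* d) := (ε :* ε) :* (d :* d)) refl ε d)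
          (subgraph-edges {δ} {ℕ→ℚ (suc s)} {ℕ→ℚ (edges H)} (ℚ.<⇒≤ 0<δ) δ≤1+s
            (subst₂ _≤ℚ_ (ℕ→ℚ-* (suc s) (suc s)) (ℕ→ℚ-* 2 (edges H)) (ℕ→ℚ-mono-≤ {suc s * suc s} {2 * edges H} eH)))
    contraction : DenseMinor G ℓ s (suc D) → Outcome-ii
    contraction M = G' , minor , density≥ G' ((ℕ→ℚ ℓ *ℚ ½) *ℚ (1ℚ -ℚ ℕ→ℚ (2 * ℓ) *ℚ ε) *ℚ d) nonempty
      (subst (λ x → (ℕ→ℚ ℓ *ℚ ½) *ℚ (1ℚ -ℚ x *ℚ ε) *ℚ d *ℚ ℕ→ℚ N ≤ℚ ℕ→ℚ (edges G')) (≡-sym (ℕ→ℚ-* 2 ℓ))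
        (minor-edges {ℕ→ℚ ℓ} {ε} {d} {ℕ→ℚ (suc D)} {ℕ→ℚ s} {ℕ→ℚ N} {ℕ→ℚ (edges G')}
          (0≤ℕ→ℚ ℓ) ℓ+1≤ℓ² (0≤ℕ→ℚ N) d≤1+D (ℚ.<⇒≤ s<δ) 1≤δ
          (subst₂ _≤ℚ_ lhs rhs (ℕ→ℚ-mono-≤ {N * (ℓ * suc D)} {2 * edges G' + N * (ℓ * s + ℓ * ℓ * s + 1)} dense))))
      where
      open DenseMinor M
      N = n G'
      lhs : ℕ→ℚ (N * (ℓ * suc D)) ≡ ℕ→ℚ N *ℚ (ℕ→ℚ ℓ *ℚ ℕ→ℚ (suc D))
      lhs = trans (ℕ→ℚ-* N (ℓ * suc D)) (cong (ℕ→ℚ N *ℚ_) (ℕ→ℚ-* ℓ (suc D)))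
      rhs : ℕ→ℚ (2 * edges G' + N * (ℓ * s + ℓ * ℓ * s + 1))
          ≡ ℕ→ℚ 2 *ℚ ℕ→ℚ (edges G') +ℚ ℕ→ℚ N *ℚ (ℕ→ℚ ℓ *ℚ ℕ→ℚ s +ℚ ℕ→ℚ ℓ *ℚ ℕ→ℚ ℓ *ℚ ℕ→ℚ s +ℚ 1ℚ)
      rhs = trans (ℕ→ℚ-+ (2 * edges G') (N * (ℓ * s + ℓ * ℓ * s + 1))) (cong₂ _+ℚ_ (ℕ→ℚ-* 2 (edges G'))
              (trans (ℕ→ℚ-* N (ℓ * s + ℓ * ℓ * s + 1)) (cong (ℕ→ℚ N *ℚ_)
                (trans (ℕ→ℚ-+ (ℓ * s + ℓ * ℓ * s) 1) (cong (_+ℚ 1ℚ)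
                  (trans (ℕ→ℚ-+ (ℓ * s) (ℓ * ℓ * s)) (cong₂ _+ℚ_ (ℕ→ℚ-* ℓ s)
                    (trans (ℕ→ℚ-* (ℓ * ℓ) s) (cong (_*ℚ ℕ→ℚ s) (ℕ→ℚ-* ℓ ℓ))))))))))
    outcome : Outcome-i ⊎ Outcome-ii
    outcome = map-⊎ subgraph contraction (dense-subgraph-or-minor G side ℓ s (suc D) (ℕ.≤-trans (s≤s z≤n) 2≤ℓ)
      (ℕ→ℚ-cancel-< {s} {suc D} (ℚ.<-≤-trans s<δ (ℚ.≤-trans δ≤d d≤1+D))) large
      -- Degrees are integers: a degree that is at least `d > D` is at least `suc D`.
      (λ a a∈A → ℕ→ℚ-cancel-< {D} {degInB G side a} (ℚ.<-≤-trans D<d (degrees a a∈A))))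
  conclude : (∃ λ D → ℕ→ℚ D <ℚ d × d ≤ℚ ℕ→ℚ (suc D)) → (∃ λ s → ℕ→ℚ s <ℚ δ × δ ≤ℚ ℕ→ℚ (suc s)) → Outcome-i ⊎ Outcome-ii
  conclude (D , D<d , d≤1+D) (s , s<δ , δ≤1+s) = Rounded.outcome D s D<d d≤1+D s<δ δ≤1+s
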